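{- Let $G$ be a connected block graph on $n$ vertices with set of cut vertices $V_c(G)$ and $k$ an integer with $2\le k\le n$. Then $$SW_k(G)=\sum_{v\in V_c(G)} B_k(v) + (k-1)\binom{n}{k}.$$
   Context: A block graph is a graph in which every block (maximal connected induced subgraph without cut vertices) is a clique. For connected $G$ and $S\subseteq V(G)$, the Steiner distance $d(S)$ is the minimum number of edges of a connected subgraph whose vertex set contains $S$; such a minimum subgraph is a tree, called a Steiner tree for $S$; vertices of $S$ are its terminal vertices and the other vertices its inner vertices. $SW_k(G)=\sum_{S\subseteq V(G),|S|=k} d(S)$. The $k$-Steiner betweenness centrality of $v$ is $$B_k(v)=\sum_{A\subseteq V(G)\setminus\{v\},\ |A|=k}\frac{\sigma_A(v)}{\sigma_A},$$ where $\sigma_A$ is the number of Steiner trees for $A$ and $\sigma_A(v)$ is the number of those containing $v$ as an inner vertex. -}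

module Defs where

open import Data.Bool.Base using (_∧_)
open import Data.Fin.Base using (Fin)
open import Data.Fin.Properties using (_≟_; _<?_; any?; all?)
open import Data.Fin.Subset using (Subset; inside; outside; _∈_; _∉_; _⊆_; _-_; ∣_∣; ⊤)
open import Data.Fin.Subset.Properties using (_∈?_; _⊆?_)
open import Data.Integer.Base using (+_)
open import Data.List.Base using (List; []; _∷_; _++_; map; filter; length; lookup; foldr; allFin; cartesianProduct)
open import Data.List.Extrema.Nat using (min)
open import Data.List.Membership.Propositional using () renaming (_∈_ to _∈ˡ_)
open import Data.List.Membership.Propositional.Properties using (∈-allFin)
open import Data.List.Relation.Unary.Any using (here; there)
open import Data.Nat.Base using (ℕ; zero; suc)
open import Data.Nat.ListAction using (sum)
import Data.Nat.Properties as ℕ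
open import Data.Product.Base using (_×_; _,_; proj₁; proj₂; ∃; ∃₂)
open import Data.Product.Properties using (≡-dec)
open import Data.Rational.Base using (ℚ; 0ℚ; _/_) renaming (_+_ to _+ℚ_)
open import Data.Sum.Base using (_⊎_; inj₁; inj₂)
open import Data.Vec.Base using (tabulate)
  renaming ([] to []ᵛ; _∷_ to _∷ᵛ_)
open import Level using (0ℓ)
open import Relation.Binary.Construct.Closure.ReflexiveTransitive using (Star; ε; _◅_; _◅◅_)
open import Relation.Binary.Core using (Rel)
open import Relation.Binary.Definitions using (Symmetric; Irreflexive; Decidable)
open import Relation.Binary.PropositionalEquality.Core using (_≡_; _≢_; refl)
open import Relation.Nullary.Decidable using (Dec; does; map′; ¬?; _×-dec_; _⊎-dec_; _→-dec_)
open import Relation.Nullary.Negation using (¬_)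

-- Reachability in a finite digraph is decidable (Warshall's algorithm):
-- Via xs i j holds when j is reachable from i through intermediate vertices in xs.
module _ {n : ℕ} {R : Rel (Fin n) 0ℓ} (R? : Decidable R) where

  private
    Via : List (Fin n) → Rel (Fin n) 0ℓ
    Via []       i j = i ≡ j ⊎ R i j
    Via (x ∷ xs) i j = Via xs i j ⊎ (Via xs i x × Via xs x j)

    via? : ∀ xs → Decidable (Via xs)
    via? []       i j = (i ≟ j) ⊎-dec R? i j
    via? (x ∷ xs) i j = via? xs i j ⊎-dec (via? xs i x ×-dec via? xs x j)

    via-refl : ∀ xs {i} → Via xs i i
    via-refl []       = inj₁ refl
    via-refl (x ∷ xs) = inj₁ (via-refl xs)

    via-step : ∀ xs {i j} → R i j → Via xs i j
    via-step []       r = inj₂ r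
    via-step (x ∷ xs) r = inj₁ (via-step xs r)

    via-trans : ∀ xs {i j k} → j ∈ˡ xs → Via xs i j → Via xs j k → Via xs i k
    via-trans (x ∷ xs) (here refl) (inj₁ p)       (inj₁ q)       = inj₂ (p , q)
    via-trans (x ∷ xs) (here refl) (inj₁ p)       (inj₂ (_ , q)) = inj₂ (p , q)
    via-trans (x ∷ xs) (here refl) (inj₂ (p , _)) (inj₁ q)       = inj₂ (p , q)
    via-trans (x ∷ xs) (here refl) (inj₂ (p , _)) (inj₂ (_ , q)) = inj₂ (p , q)
    via-trans (x ∷ xs) (there m)   (inj₁ p)       (inj₁ q)       = inj₁ (via-trans xs m p q)
    via-trans (x ∷ xs) (there m)   (inj₁ p)       (inj₂ (q , r)) = inj₂ (via-trans xs m p q , r)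
    via-trans (x ∷ xs) (there m)   (inj₂ (p , q)) (inj₁ r)       = inj₂ (p , via-trans xs m q r)
    via-trans (x ∷ xs) (there m)   (inj₂ (p , _)) (inj₂ (_ , q)) = inj₂ (p , q)

    via⇒star : ∀ xs {i j} → Via xs i j → Star R i j
    via⇒star []       (inj₁ refl)    = ε
    via⇒star []       (inj₂ r)       = r ◅ ε
    via⇒star (x ∷ xs) (inj₁ p)       = via⇒star xs p
    via⇒star (x ∷ xs) (inj₂ (p , q)) = via⇒star xs p ◅◅ via⇒star xs q

    star⇒via : ∀ {i j} → Star R i j → Via (allFin n) i j
    star⇒via ε        = via-refl (allFin n)
    star⇒via (r ◅ rs) =
      via-trans (allFin n) (∈-allFin _) (via-step (allFin n) r) (star⇒via rs)

  star? : Decidable (Star R)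
  star? i j = map′ (via⇒star (allFin n)) star⇒via (via? (allFin n) i j)

subsets : ∀ n → List (Subset n)
subsets zero    = []ᵛ ∷ []
subsets (suc n) = map (inside ∷ᵛ_) (subsets n) ++ map (outside ∷ᵛ_) (subsets n)

subsetsOfSize : ∀ n → ℕ → List (Subset n)
subsetsOfSize n k = filter (λ S → ∣ S ∣ ℕ.≟ k) (subsets n)

sumℚ : List ℚ → ℚ
sumℚ = foldr _+ℚ_ 0ℚ

-- The quotient a / b, with the convention a / 0 = 0.
ratio : ℕ → ℕ → ℚ
ratio a zero    = 0ℚ
ratio a (suc b) = + a / suc b

record Graph (n : ℕ) : Set₁ where
  infix 4 _~_ _~?_
  field
    _~_      : Rel (Fin n) 0ℓ
    ~-sym    : Symmetric _~_
    ~-irrefl : Irreflexive _≡_ _~_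
    _~?_     : Decidable _~_

module _ {n : ℕ} (G : Graph n) where

  open Graph G

  -- Each edge {u , v} is listed exactly once, as the pair (u , v) with u < v.
  edgeList : List (Fin n × Fin n)
  edgeList = filter (λ (u , v) → (u <? v) ×-dec (u ~? v))
                    (cartesianProduct (allFin n) (allFin n))

  size : ℕ
  size = length edgeList

  end₁ end₂ : Fin size → Fin n
  end₁ e = proj₁ (lookup edgeList e)
  end₂ e = proj₂ (lookup edgeList e)

  -- A vertex set together with an edge set (edges are positions in edgeList).
  -- It is an actual subgraph of G when IsSubgraph holds; keeping the two apart
  -- means that distinct values are distinct subgraphs.
  record VertexEdgeSet : Set where
    constructor _,ᵍ_
    field
      V : Subset n
      E : Subset size

  open VertexEdgeSet public

  IsSubgraph : VertexEdgeSet → Set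
  IsSubgraph H = ∀ e → e ∈ E H → end₁ e ∈ V H × end₂ e ∈ V H

  isSubgraph? : ∀ H → Dec (IsSubgraph H)
  isSubgraph? H = all? λ e → (e ∈? E H) →-dec ((end₁ e ∈? V H) ×-dec (end₂ e ∈? V H))

  Adjacent : VertexEdgeSet → Rel (Fin n) 0ℓ
  Adjacent H u v = ∃ λ e → e ∈ E H ×
    (lookup edgeList e ≡ (u , v) ⊎ lookup edgeList e ≡ (v , u))

  adjacent? : ∀ H → Decidable (Adjacent H)
  adjacent? H u v = any? λ e → (e ∈? E H) ×-dec
    (≡-dec _≟_ _≟_ (lookup edgeList e) (u , v) ⊎-dec ≡-dec _≟_ _≟_ (lookup edgeList e) (v , u))

  -- u and v are joined by a walk in H.
  Joined : VertexEdgeSet → Rel (Fin n) 0ℓ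
  Joined H = Star (Adjacent H)

  joined? : ∀ H → Decidable (Joined H)
  joined? H = star? (adjacent? H)

  -- The graph without vertices counts as connected here.
  Connected : VertexEdgeSet → Set
  Connected H = ∀ u → u ∈ V H → ∀ v → v ∈ V H → Joined H u v

  connected? : ∀ H → Dec (Connected H)
  connected? H = all? λ u → (u ∈? V H) →-dec all? λ v → (v ∈? V H) →-dec joined? H u v

  induced : Subset n → VertexEdgeSet
  induced X = X ,ᵍ tabulate (λ e → does (end₁ e ∈? X) ∧ does (end₂ e ∈? X))

  IsConnected : Set
  IsConnected = Connected (induced ⊤)

  -- w is a cut vertex of the induced subgraph G[X]: deleting it increases the
  -- number of components, i.e. separates two vertices joined in G[X].
  IsCutVertexOf : Subset n → Fin n → Set
  IsCutVertexOf X w = w ∈ X × ∃₂ λ u v → u ∈ (X - w) × v ∈ (X - w) ×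
    Joined (induced X) u v × ¬ Joined (induced (X - w)) u v

  isCutVertexOf? : ∀ X w → Dec (IsCutVertexOf X w)
  isCutVertexOf? X w = (w ∈? X) ×-dec any? λ u → any? λ v →
    (u ∈? (X - w)) ×-dec (v ∈? (X - w)) ×-dec
    joined? (induced X) u v ×-dec ¬? (joined? (induced (X - w)) u v)

  -- The list of the elements of V_c(G).
  cutVertices : List (Fin n)
  cutVertices = filter (isCutVertexOf? ⊤) (allFin n)

  ConnectedWithoutCutVertex : Subset n → Set
  ConnectedWithoutCutVertex X =
    Connected (induced X) × (∀ w → w ∈ X → ¬ IsCutVertexOf X w)

  IsBlock : Subset n → Set
  IsBlock X = ConnectedWithoutCutVertex X ×
    (∀ Y → ConnectedWithoutCutVertex Y → X ⊆ Y → Y ⊆ X)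

  IsClique : Subset n → Set
  IsClique X = ∀ u v → u ∈ X → v ∈ X → u ≢ v → u ~ v

  IsBlockGraph : Set
  IsBlockGraph = ∀ X → IsBlock X → IsClique X

  vertexEdgeSets : List VertexEdgeSet
  vertexEdgeSets = map (λ (W , F) → W ,ᵍ F) (cartesianProduct (subsets n) (subsets size))

  Connects : Subset n → VertexEdgeSet → Set
  Connects S H = IsSubgraph H × Connected H × S ⊆ V H

  connects? : ∀ S H → Dec (Connects S H)
  connects? S H = isSubgraph? H ×-dec connected? H ×-dec (S ⊆? V H)

  -- The default value `size` passed to `min` matters only when there is no
  -- connected subgraph containing S: if G is connected, then G itself is one
  -- and has `size` edges.
  steinerDistance : Subset n → ℕ
  steinerDistance S =
    min size (map (λ H → ∣ E H ∣) (filter (connects? S) vertexEdgeSets))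

  SW : ℕ → ℕ
  SW k = sum (map steinerDistance (subsetsOfSize n k))

  IsSteinerTree : Subset n → VertexEdgeSet → Set
  IsSteinerTree S H = Connects S H × ∣ E H ∣ ≡ steinerDistance S

  isSteinerTree? : ∀ S H → Dec (IsSteinerTree S H)
  isSteinerTree? S H = connects? S H ×-dec (∣ E H ∣ ℕ.≟ steinerDistance S)

  IsInnerVertex : Subset n → VertexEdgeSet → Fin n → Set
  IsInnerVertex S H v = v ∈ V H × v ∉ S

  isInnerVertex? : ∀ S H v → Dec (IsInnerVertex S H v)
  isInnerVertex? S H v = (v ∈? V H) ×-dec ¬? (v ∈? S)

  steinerTrees : Subset n → List VertexEdgeSet
  steinerTrees S = filter (isSteinerTree? S) vertexEdgeSets

  σ : Subset n → ℕ
  σ A = length (steinerTrees A)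

  σ-inner : Subset n → Fin n → ℕ
  σ-inner A v = length (filter (λ H → isInnerVertex? A H v) (steinerTrees A))

  -- σ A is nonzero for every A when G is connected.
  B : ℕ → Fin n → ℚ
  B k v = sumℚ (map (λ A → ratio (σ-inner A v) (σ A))
                    (filter (λ A → ¬? (v ∈? A)) (subsetsOfSize n k)))

module Submission where

-- Growing a subtree along crossing edges gives every connected graph with m ≥ 1
-- vertices a connected spanning subgraph with m - 1 edges, so a Steiner tree for
-- S has d(S) + 1 vertices and d(S) - (|S| - 1) inner ones. In a block graph the
-- neighbours a, b of a non-cut vertex v are adjacent: a path from a to b avoiding
-- v closes to a cycle through v, which lies in a block. Hence v can be bypassed
-- and is never an inner vertex of a Steiner tree. Counting the pairs (Steiner
-- tree for S, inner vertex) in two ways, with weight 1 / σ(S), gives the formula.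

open import Defs
open import Algebra.Bundles using (CommutativeMonoid)
import Algebra.Properties.CommutativeSemigroup as CommutativeSemigroup
open import Data.Bool.Base using (true; _∧_)
open import Data.Empty using (⊥-elim)
open import Data.Fin.Base using (Fin; zero; suc)
open import Data.Fin.Properties using (_≟_; _<?_; <-cmp; any?; all?)
open import Data.Fin.Subset
  using (Subset; inside; outside; _∈_; _∉_; _⊆_; _∪_; _─_; _-_; ⁅_⁆; ⊤; ⊥; ∣_∣)
open import Data.Fin.Subset.Properties
  using ( _∈?_; _⊆?_; ∈⊤; ∉⊥; ⊆-refl; ⊆-trans; ⊆-antisym; x∈⁅x⁆; x∈⁅y⁆⇒x≡y; p⊆p∪q; q⊆p∪q; x∈p∪q⁻
        ; ∪-identityʳ; p─q⊆p; x∈p∧x≢y⇒x∈p-y; x∈p∧x∉q⇒x∈p─q; ∣p∣≤n; ∣⊥∣≡0; ∣⁅x⁆∣≡1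
        ; p⊆q⇒∣p∣≤∣q∣; p⊂q⇒∣p∣<∣q∣; x∈p⇒∣p-x∣<∣p∣; anySubset?; drop-there)
open import Data.Integer.Base using (+_)
import Data.Integer.Base as ℤ
import Data.Integer.Properties as ℤ
open import Data.Integer.Tactic.RingSolver using (solve-∀)
open import Data.List.Base
  using (List; []; _∷_; _++_; map; filter; length; lookup; allFin; tabulate; cartesianProduct)
open import Data.List.Extrema.Nat using (min≤xs; argmin-sel)
open import Data.List.Membership.Propositional using () renaming (_∈_ to _∈ˡ_)
open import Data.List.Membership.Propositional.Properties
  using ( ∈-allFin; ∈-filter⁺; ∈-filter⁻; ∈-cartesianProduct⁺; ∈-lookup
        ; ∈-map⁺; ∈-map⁻; ∈-++⁺ˡ; ∈-++⁺ʳ)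
open import Data.List.Properties
  using (map-cong-local; length-++; filter-++; filter-none)
import Data.List.Relation.Unary.All as All
import Data.List.Relation.Unary.All.Properties as All
import Data.List.Relation.Unary.Any as Any
open import Data.List.Relation.Unary.Any.Properties using (lookup-index)
open import Data.Nat.Base using (ℕ; zero; suc; _≤_; _<_; _∸_; _*_)
import Data.Nat.Base as ℕ
open import Data.Nat.Combinatorics using (_C_; nCk+nC[k+1]≡[n+1]C[k+1])
open import Data.Nat.ListAction using (sum)
import Data.Nat.Properties as ℕ
open import Data.Product.Base using (_×_; _,_; proj₁; proj₂; ∃; ∃₂)
open import Data.Rational.Base using (ℚ; 0ℚ; _/_; _+_; toℚᵘ)
import Data.Rational.Properties as ℚ
import Data.Rational.Unnormalised.Base as ℚᵘ
import Data.Rational.Unnormalised.Properties as ℚᵘ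
open import Data.Sum.Base using (_⊎_; inj₁; inj₂; [_,_]′; swap)
open import Data.Vec.Base using ([]; _∷_; here; there)
open import Data.Vec.Properties using (lookup⇒[]=; []=⇒lookup; lookup∘tabulate)
open import Function.Base using (id; _∘_)
open import Level using (0ℓ)
open import Relation.Binary.Construct.Closure.ReflexiveTransitive using (Star; ε; _◅_; _◅◅_)
import Relation.Binary.Construct.Closure.ReflexiveTransitive as Star
open import Relation.Binary.Core using (Rel)
open import Relation.Binary.Definitions using (tri<; tri≈; tri>)
open import Relation.Binary.PropositionalEquality
  using (_≡_; _≢_; refl; sym; trans; cong; cong₂; subst; module ≡-Reasoning)
open import Relation.Nullary.Decidable
  using (Dec; yes; no; does; ¬?; _×-dec_; _→-dec_; dec-true)
open import Relation.Nullary.Negation using (¬_; contradiction)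
open import Relation.Unary using (Pred; Decidable)

open CommutativeSemigroup ℕ.+-commutativeSemigroup using (x∙yz≈y∙xz)
open CommutativeSemigroup (CommutativeMonoid.commutativeSemigroup ℚ.+-0-commutativeMonoid)
  using () renaming (interchange to medial)

-- Finite subsets

x∈p─q⇒x∉q : ∀ {n} {p q : Subset n} {x} → x ∈ p ─ q → x ∉ q
x∈p─q⇒x∉q {p = _ ∷ _} {_ ∷ _} {zero}  () here
x∈p─q⇒x∉q {p = _ ∷ _} {_ ∷ _} {suc x} (there x∈p─q) (there x∈q) = x∈p─q⇒x∉q x∈p─q x∈q

x∈p-y⇒x≢y : ∀ {n} {p : Subset n} {x y} → x ∈ p - y → x ≢ y
x∈p-y⇒x≢y {x = x} x∈p-x refl = x∈p─q⇒x∉q x∈p-x (x∈⁅x⁆ x)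

p-x⊆p : ∀ {n} {p : Subset n} {x} → p - x ⊆ p
p-x⊆p {p = p} {x} = p─q⊆p p ⁅ x ⁆

-⊆- : ∀ {n} {p q : Subset n} {x} → p ⊆ q → p - x ⊆ q - x
-⊆- p⊆q y∈ = x∈p∧x≢y⇒x∈p-y (p⊆q (p-x⊆p y∈)) (x∈p-y⇒x≢y y∈)

∈-∪⁅⁆⁻ : ∀ {n} {p : Subset n} {x y} → y ∈ p ∪ ⁅ x ⁆ → y ∈ p ⊎ y ≡ x
∈-∪⁅⁆⁻ {p = p} {x} y∈ with x∈p∪q⁻ p ⁅ x ⁆ y∈
... | inj₁ y∈p = inj₁ y∈p
... | inj₂ y∈x = inj₂ (x∈⁅y⁆⇒x≡y x y∈x)

∣p∪⁅x⁆∣≡1+∣p∣ : ∀ {n} {p : Subset n} {x} → x ∉ p → ∣ p ∪ ⁅ x ⁆ ∣ ≡ suc ∣ p ∣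
∣p∪⁅x⁆∣≡1+∣p∣ {p = outside ∷ p} {zero}  x∉p = cong (suc ∘ ∣_∣) (∪-identityʳ p)
∣p∪⁅x⁆∣≡1+∣p∣ {p = inside  ∷ p} {zero}  x∉p = contradiction here x∉p
∣p∪⁅x⁆∣≡1+∣p∣ {p = outside ∷ p} {suc x} x∉p = ∣p∪⁅x⁆∣≡1+∣p∣ (x∉p ∘ there)
∣p∪⁅x⁆∣≡1+∣p∣ {p = inside  ∷ p} {suc x} x∉p = cong suc (∣p∪⁅x⁆∣≡1+∣p∣ (x∉p ∘ there))

∣q─p∣+∣p∣≡∣q∣ : ∀ {n} {p q : Subset n} → p ⊆ q → ∣ q ─ p ∣ ℕ.+ ∣ p ∣ ≡ ∣ q ∣
∣q─p∣+∣p∣≡∣q∣ {p = []}          {[]}          p⊆q = refl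
∣q─p∣+∣p∣≡∣q∣ {p = outside ∷ p} {outside ∷ q} p⊆q = ∣q─p∣+∣p∣≡∣q∣ (drop-there ∘ p⊆q ∘ there)
∣q─p∣+∣p∣≡∣q∣ {p = outside ∷ p} {inside  ∷ q} p⊆q = cong suc (∣q─p∣+∣p∣≡∣q∣ (drop-there ∘ p⊆q ∘ there))
∣q─p∣+∣p∣≡∣q∣ {p = inside  ∷ p} {outside ∷ q} p⊆q with () ← p⊆q here
∣q─p∣+∣p∣≡∣q∣ {p = inside  ∷ p} {inside  ∷ q} p⊆q =
  trans (ℕ.+-suc ∣ q ─ p ∣ ∣ p ∣) (cong suc (∣q─p∣+∣p∣≡∣q∣ (drop-there ∘ p⊆q ∘ there)))

1≤∣p∣⇒nonempty : ∀ {n} {p : Subset n} → 1 ≤ ∣ p ∣ → ∃ λ x → x ∈ p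
1≤∣p∣⇒nonempty {p = inside  ∷ p} _   = zero , here
1≤∣p∣⇒nonempty {p = outside ∷ p} 1≤p = let x , x∈p = 1≤∣p∣⇒nonempty 1≤p in suc x , there x∈p

-- Enumerating and counting subsets

subsets-complete : ∀ {n} (p : Subset n) → p ∈ˡ subsets n
subsets-complete []            = Any.here refl
subsets-complete (inside  ∷ p) = ∈-++⁺ˡ (∈-map⁺ (inside ∷_) (subsets-complete p))
subsets-complete (outside ∷ p) = ∈-++⁺ʳ _ (∈-map⁺ (outside ∷_) (subsets-complete p))

-- The function `f` is arbitrary so that the induction can pass to `f ∘ suc`; the case of interest
-- is `f = id`, as `allFin n` is `tabulate id`.
length-filter-tabulate : ∀ {n} {A : Set} {P : Pred A 0ℓ} (P? : Decidable P) (f : Fin n → A) (p : Subset n) →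
  (∀ {i} → P (f i) → i ∈ p) → (∀ {i} → i ∈ p → P (f i)) → length (filter P? (tabulate f)) ≡ ∣ p ∣
length-filter-tabulate P? f []      to from = refl
length-filter-tabulate P? f (s ∷ p) to from
  with ih ← length-filter-tabulate P? (f ∘ suc) p (drop-there ∘ to) (from ∘ there) | P? (f zero)
length-filter-tabulate P? f (inside  ∷ p) to from | yes p0 = cong suc ih
length-filter-tabulate P? f (inside  ∷ p) to from | no ¬p0 = contradiction (from here) ¬p0
length-filter-tabulate P? f (outside ∷ p) to from | yes p0 with () ← to p0
length-filter-tabulate P? f (outside ∷ p) to from | no ¬p0 = ih

length-filter-map : ∀ {A B : Set} {P : Pred A 0ℓ} {Q : Pred B 0ℓ} (P? : Decidable P) (Q? : Decidable Q) (f : A → B) →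
  (∀ {x} → P x → Q (f x)) → (∀ {x} → Q (f x) → P x) →
  ∀ xs → length (filter Q? (map f xs)) ≡ length (filter P? xs)
length-filter-map P? Q? f to from []       = refl
length-filter-map P? Q? f to from (x ∷ xs)
  with ih ← length-filter-map P? Q? f to from xs | P? x | Q? (f x)
... | yes _  | yes _  = cong suc ih
... | no _   | no _   = ih
... | yes px | no ¬qx = contradiction (to px) ¬qx
... | no ¬px | yes qx = contradiction (from qx) ¬px

-- Pascal's rule: `subsets` lists first the sets that contain `zero`, then those that do not.
length-subsetsOfSize : ∀ n k → length (subsetsOfSize n k) ≡ n C k
length-subsetsOfSize zero    zero    = refl
length-subsetsOfSize zero    (suc k) = refl
length-subsetsOfSize (suc n) k = begin
  length (filter size? (map (inside ∷_) (subsets n) ++ map (outside ∷_) (subsets n)))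
    ≡⟨ cong length (filter-++ size? (map (inside ∷_) (subsets n)) _) ⟩
  length (filter size? (map (inside ∷_) (subsets n)) ++ filter size? (map (outside ∷_) (subsets n)))
    ≡⟨ length-++ (filter size? (map (inside ∷_) (subsets n))) ⟩
  length (filter size? (map (inside ∷_) (subsets n))) ℕ.+ length (filter size? (map (outside ∷_) (subsets n)))
    ≡⟨ cong (length (filter size? (map (inside ∷_) (subsets n))) ℕ.+_)
         (trans (length-filter-map (λ S → ∣ S ∣ ℕ.≟ k) size? (outside ∷_) id id (subsets n))
                (length-subsetsOfSize n k)) ⟩
  length (filter size? (map (inside ∷_) (subsets n))) ℕ.+ n C k
    ≡⟨ pascal k ⟩
  suc n C k ∎
  where
  open ≡-Reasoning
  size? : Decidable (λ (S : Subset (suc n)) → ∣ S ∣ ≡ k)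
  size? S = ∣ S ∣ ℕ.≟ k
  pascal : ∀ k → length (filter (λ S → ∣ S ∣ ℕ.≟ k) (map (inside ∷_) (subsets n))) ℕ.+ n C k ≡ suc n C k
  pascal zero = cong (λ xs → length xs ℕ.+ n C 0)
    (filter-none (λ S → ∣ S ∣ ℕ.≟ 0) (All.map⁺ (All.tabulate {xs = subsets n} λ _ ())))
  pascal (suc k) = trans
    (cong (ℕ._+ n C suc k)
      (trans (length-filter-map (λ S → ∣ S ∣ ℕ.≟ k) (λ S → ∣ S ∣ ℕ.≟ suc k) (inside ∷_)
                (cong suc) ℕ.suc-injective (subsets n))
             (length-subsetsOfSize n k)))
    (nCk+nC[k+1]≡[n+1]C[k+1] n k)

-- Sums over lists

∈⇒length≢0 : ∀ {A : Set} {x : A} {xs} → x ∈ˡ xs → length xs ≢ 0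
∈⇒length≢0 (Any.here _)  ()
∈⇒length≢0 (Any.there _) ()

length-filter-none : ∀ {A : Set} {P : Pred A 0ℓ} (P? : Decidable P) xs →
                     (∀ x → x ∈ˡ xs → ¬ P x) → length (filter P? xs) ≡ 0
length-filter-none P? xs none = cong length (filter-none P? (All.tabulate λ {x} → none x))

sum-map-constant : ∀ {A : Set} (f : A → ℕ) xs {c} → (∀ {x} → x ∈ˡ xs → f x ≡ c) →
                   sum (map f xs) ≡ length xs * c
sum-map-constant f []       f≡c = refl
sum-map-constant f (x ∷ xs) f≡c =
  cong₂ ℕ._+_ (f≡c (Any.here refl)) (sum-map-constant f xs (f≡c ∘ Any.there))

-- Double counting of the related pairs, by rows and by columns: a further row `x` raises by one
-- exactly the columns `y` with `R x y`.
sum-length-filter-swap : ∀ {A B : Set} {R : A → B → Set} (R? : ∀ x y → Dec (R x y)) xs ys →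
  sum (map (λ x → length (filter (R? x) ys)) xs) ≡ sum (map (λ y → length (filter (λ x → R? x y) xs)) ys)
sum-length-filter-swap R? []       ys = sym (trans (sum-map-constant (λ _ → 0) ys λ _ → refl) (ℕ.*-zeroʳ (length ys)))
sum-length-filter-swap R? (x ∷ xs) ys =
  trans (cong (length (filter (R? x) ys) ℕ.+_) (sum-length-filter-swap R? xs ys)) (add ys)
  where
  column : _ → ℕ
  column y = length (filter (λ x → R? x y) xs)
  add : ∀ ys → length (filter (R? x) ys) ℕ.+ sum (map column ys) ≡
               sum (map (λ y → length (filter (λ x → R? x y) (x ∷ xs))) ys)
  add [] = refl
  add (y ∷ ys) with ih ← trans (x∙yz≈y∙xz (length (filter (R? x) ys)) (column y) (sum (map column ys)))
                               (cong (column y ℕ.+_) (add ys))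
               | R? x y
  ... | yes _ = cong suc ih
  ... | no  _ = ih

module _ {A : Set} where

  sumℚ-map-+ : ∀ (f g : A → ℚ) xs → sumℚ (map (λ x → f x + g x) xs) ≡ sumℚ (map f xs) + sumℚ (map g xs)
  sumℚ-map-+ f g []       = refl
  sumℚ-map-+ f g (x ∷ xs) = trans (cong (λ q → (f x + g x) + q) (sumℚ-map-+ f g xs))
                                  (medial (f x) (g x) (sumℚ (map f xs)) (sumℚ (map g xs)))

  sumℚ-cong : ∀ (f g : A → ℚ) xs → (∀ {x} → x ∈ˡ xs → f x ≡ g x) → sumℚ (map f xs) ≡ sumℚ (map g xs)
  sumℚ-cong f g xs f≡g = cong sumℚ (map-cong-local (All.tabulate f≡g))

  sumℚ-zero : ∀ (f : A → ℚ) xs → (∀ {x} → x ∈ˡ xs → f x ≡ 0ℚ) → sumℚ (map f xs) ≡ 0ℚ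
  sumℚ-zero f []       f≡0 = refl
  sumℚ-zero f (x ∷ xs) f≡0 = cong₂ _+_ (f≡0 (Any.here refl)) (sumℚ-zero f xs (f≡0 ∘ Any.there))

  sumℚ-swap : ∀ {B : Set} (f : A → B → ℚ) xs ys →
    sumℚ (map (λ x → sumℚ (map (f x) ys)) xs) ≡ sumℚ (map (λ y → sumℚ (map (λ x → f x y) xs)) ys)
  sumℚ-swap f []       ys = sym (go ys)
    where
    go : ∀ ys → sumℚ (map (λ _ → 0ℚ) ys) ≡ 0ℚ
    go []       = refl
    go (_ ∷ ys) = trans (ℚ.+-identityˡ _) (go ys)
  sumℚ-swap f (x ∷ xs) ys = trans (cong (λ q → sumℚ (map (f x) ys) + q) (sumℚ-swap f xs ys)) (sym (add ys))
    where
    add : ∀ ys → sumℚ (map (λ y → f x y + sumℚ (map (λ x → f x y) xs)) ys) ≡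
                 sumℚ (map (f x) ys) + sumℚ (map (λ y → sumℚ (map (λ x → f x y) xs)) ys)
    add []       = refl
    add (y ∷ ys) = trans (cong (λ q → (f x y + sumℚ (map (λ x → f x y) xs)) + q) (add ys)) (medial (f x y) _ _ _)

  -- Serves twice: to restrict a sum over all sets of size `k` to those that avoid `v`, and a sum
  -- over all vertices to the cut vertices.
  sumℚ-filter : ∀ {P : Pred A 0ℓ} (P? : Decidable P) (f : A → ℚ) xs →
    (∀ {x} → x ∈ˡ xs → ¬ P x → f x ≡ 0ℚ) → sumℚ (map f xs) ≡ sumℚ (map f (filter P? xs))
  sumℚ-filter P? f []       f≡0 = refl
  sumℚ-filter P? f (x ∷ xs) f≡0 with ih ← sumℚ-filter P? f xs (f≡0 ∘ Any.there) | P? x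
  ... | yes _  = cong (λ q → f x + q) ih
  ... | no ¬px = trans (cong₂ _+_ (f≡0 (Any.here refl) ¬px) ih) (ℚ.+-identityˡ _)

-- Quotients of natural numbers in the rationals

ratio-zero : ∀ b → ratio 0 b ≡ 0ℚ
ratio-zero zero    = refl
ratio-zero (suc b) = ℚ.0/n≡0 (suc b)

-- The sum is taken in the unnormalised rationals, where equality is cross-multiplication and
-- reduces to the ring identity `common`. For `b = 0` all quotients are `0ℚ` by convention.
ratio-+ : ∀ a c b → ratio a b + ratio c b ≡ ratio (a ℕ.+ c) b
ratio-+ a c zero    = refl
ratio-+ a c (suc b) = ℚ.toℚᵘ-injective (begin
  toℚᵘ (+ a / suc b + + c / suc b)            ≈⟨ ℚ.toℚᵘ-homo-+ (+ a / suc b) (+ c / suc b) ⟩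
  toℚᵘ (+ a / suc b) ℚᵘ.+ toℚᵘ (+ c / suc b)  ≈⟨ ℚᵘ.+-cong (ℚ.toℚᵘ-fromℚᵘ (ℚᵘ.mkℚᵘ (+ a) b)) (ℚ.toℚᵘ-fromℚᵘ (ℚᵘ.mkℚᵘ (+ c) b)) ⟩
  ℚᵘ.mkℚᵘ (+ a) b ℚᵘ.+ ℚᵘ.mkℚᵘ (+ c) b        ≈⟨ ℚᵘ.*≡* (common (+ a) (+ c) (+ suc b)) ⟩
  ℚᵘ.mkℚᵘ (+ (a ℕ.+ c)) b                     ≈⟨ ℚ.toℚᵘ-fromℚᵘ (ℚᵘ.mkℚᵘ (+ (a ℕ.+ c)) b) ⟨
  toℚᵘ (+ (a ℕ.+ c) / suc b)                  ∎)
  where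
  open ℚᵘ.≃-Reasoning
  common : ∀ x y d → (x ℤ.* d ℤ.+ y ℤ.* d) ℤ.* d ≡ (x ℤ.+ y) ℤ.* (d ℤ.* d)
  common = solve-∀

-- Under the convention `a / 0 = 0` the case `b = 0` would fail for nonzero `a`. In the application
-- `b` is the number of Steiner trees.
ratio-cancel : ∀ b a → b ≢ 0 → ratio (b * a) b ≡ ratio a 1
ratio-cancel zero    a b≢0 = contradiction refl b≢0
ratio-cancel (suc b) a _   = ℚ.fromℚᵘ-cong {ℚᵘ.mkℚᵘ (+ (suc b * a)) b} {ℚᵘ.mkℚᵘ (+ a) 0} (ℚᵘ.*≡*
  (trans (ℤ.*-identityʳ (+ (suc b * a))) (trans (cong +_ (ℕ.*-comm (suc b) a)) (ℤ.pos-* a (suc b)))))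

sum-ratio : ∀ {A : Set} b (f : A → ℕ) xs → sumℚ (map (λ x → ratio (f x) b) xs) ≡ ratio (sum (map f xs)) b
sum-ratio b f []       = sym (ratio-zero b)
sum-ratio b f (x ∷ xs) = trans (cong (λ q → ratio (f x) b + q) (sum-ratio b f xs)) (ratio-+ (f x) _ b)

-- Subgraphs

-- Take the first step of the walk that leaves `P`. With `P` the vertex set of a partial tree, it is
-- the edge along which the tree grows.
crossing : ∀ {A : Set} {R : Rel A 0ℓ} {P : Pred A 0ℓ} → Decidable P →
           ∀ {x y} → Star R x y → P x → ¬ P y → ∃₂ λ u v → R u v × P u × ¬ P v
crossing P? ε          px ¬py = contradiction px ¬py
crossing P? (_◅_ {j = z} r rs) px ¬py with P? z
... | yes pz = crossing P? rs pz ¬py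
... | no ¬pz = _ , _ , r , px , ¬pz

module _ {n : ℕ} (G : Graph n) where

  open Graph G

  -- Walks

  Adjacent-sym : ∀ H {u v} → Adjacent G H u v → Adjacent G H v u
  Adjacent-sym H (e , e∈E , ends) = e , e∈E , swap ends

  Joined-sym : ∀ H {u v} → Joined G H u v → Joined G H v u
  Joined-sym H = Star.reverse (Adjacent-sym H)

  Adjacent-∈ : ∀ {H} → IsSubgraph G H → ∀ {u v} → Adjacent G H u v → u ∈ V H × v ∈ V H
  Adjacent-∈ {H} sub (e , e∈E , inj₁ eq) =
    subst (λ p → proj₁ p ∈ V H × proj₂ p ∈ V H) eq (sub e e∈E)
  Adjacent-∈ {H} sub (e , e∈E , inj₂ eq) =
    let v∈ , u∈ = subst (λ p → proj₁ p ∈ V H × proj₂ p ∈ V H) eq (sub e e∈E) in u∈ , v∈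

  edge⇒~ : ∀ e → end₁ G e ~ end₂ G e
  edge⇒~ e = proj₂ (proj₂ (∈-filter⁻ (λ (u , v) → (u <? v) ×-dec (u ~? v))
    {xs = cartesianProduct (allFin n) (allFin n)} (∈-lookup {xs = edgeList G} e)))

  Adjacent⇒~ : ∀ H {u v} → Adjacent G H u v → u ~ v
  Adjacent⇒~ H (e , _ , inj₁ eq) = subst (λ p → proj₁ p ~ proj₂ p) eq (edge⇒~ e)
  Adjacent⇒~ H (e , _ , inj₂ eq) = ~-sym (subst (λ p → proj₁ p ~ proj₂ p) eq (edge⇒~ e))

  ~⇒edge : ∀ {u v} → u ~ v → ∃ λ e → lookup (edgeList G) e ≡ (u , v) ⊎ lookup (edgeList G) e ≡ (v , u)
  ~⇒edge {u} {v} u~v with <-cmp u v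
  ... | tri< u<v _ _ = let m = ∈-filter⁺ (λ (u , v) → (u <? v) ×-dec (u ~? v))
                                 (∈-cartesianProduct⁺ (∈-allFin u) (∈-allFin v)) (u<v , u~v)
                       in Any.index m , inj₁ (sym (lookup-index m))
  ... | tri≈ _ u≡v _ = contradiction u~v (~-irrefl u≡v)
  ... | tri> _ _ v<u = let m = ∈-filter⁺ (λ (u , v) → (u <? v) ×-dec (u ~? v))
                                 (∈-cartesianProduct⁺ (∈-allFin v) (∈-allFin u)) (v<u , ~-sym u~v)
                       in Any.index m , inj₂ (sym (lookup-index m))

  induced-isSubgraph : ∀ X → IsSubgraph G (induced G X)
  induced-isSubgraph X e e∈ =
    both (end₁ G e ∈? X) (end₂ G e ∈? X) (trans (sym (lookup∘tabulate _ e)) ([]=⇒lookup e∈))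
    where
    both : ∀ {A B : Set} (a? : Dec A) (b? : Dec B) → does a? ∧ does b? ≡ true → A × B
    both (yes a) (yes b) _ = a , b

  -- This and its converse below trade positions in `edgeList` for the relation `_~_`; arguments
  -- about induced subgraphs then need no positions.
  Adjacent-induced⁻ : ∀ X {u v} → Adjacent G (induced G X) u v → u ~ v × u ∈ X × v ∈ X
  Adjacent-induced⁻ X a = Adjacent⇒~ (induced G X) a , Adjacent-∈ (induced-isSubgraph X) a

  Adjacent-induced⁺ : ∀ X {u v} → u ~ v → u ∈ X → v ∈ X → Adjacent G (induced G X) u v
  Adjacent-induced⁺ X u~v u∈X v∈X with ~⇒edge u~v
  ... | e , inj₁ eq = e , lookup⇒[]= e _ (trans (lookup∘tabulate _ e) (cong₂ _∧_
          (dec-true (end₁ G e ∈? X) (subst (_∈ X) (cong proj₁ (sym eq)) u∈X))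
          (dec-true (end₂ G e ∈? X) (subst (_∈ X) (cong proj₂ (sym eq)) v∈X)))) , inj₁ eq
  ... | e , inj₂ eq = e , lookup⇒[]= e _ (trans (lookup∘tabulate _ e) (cong₂ _∧_
          (dec-true (end₁ G e ∈? X) (subst (_∈ X) (cong proj₁ (sym eq)) v∈X))
          (dec-true (end₂ G e ∈? X) (subst (_∈ X) (cong proj₂ (sym eq)) u∈X)))) , inj₂ eq

  Joined-induced-mono : ∀ {X Y} → X ⊆ Y → ∀ {u v} → Joined G (induced G X) u v → Joined G (induced G Y) u v
  Joined-induced-mono {X} {Y} X⊆Y = Star.map λ a →
    let u~v , u∈X , v∈X = Adjacent-induced⁻ X a in Adjacent-induced⁺ Y u~v (X⊆Y u∈X) (X⊆Y v∈X)

  hub⇒Connected : ∀ H r → (∀ u → u ∈ V H → Joined G H u r) → Connected G H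
  hub⇒Connected H r hub u u∈ v v∈ = hub u u∈ ◅◅ Joined-sym H (hub v v∈)

  -- Spanning trees

  -- Acyclicity is encoded by `count`: a connected graph with one edge fewer than vertices is a
  -- tree.
  record RootedSubtree (H : VertexEdgeSet G) (r : Fin n) : Set where
    field
      W      : Subset n
      F      : Subset (size G)
      W⊆V    : W ⊆ V H
      F⊆E    : F ⊆ E H
      isSub  : IsSubgraph G (W ,ᵍ F)
      r∈W    : r ∈ W
      toRoot : ∀ u → u ∈ W → Joined G (W ,ᵍ F) u r
      count  : suc ∣ F ∣ ≡ ∣ W ∣

  module _ {H : VertexEdgeSet G} (sub : IsSubgraph G H) (conn : Connected G H)
           {r : Fin n} (r∈V : r ∈ V H) where

    singleton : RootedSubtree H r
    singleton = record
      { W      = ⁅ r ⁆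
      ; F      = ⊥
      ; W⊆V    = λ x∈ → subst (_∈ V H) (sym (x∈⁅y⁆⇒x≡y r x∈)) r∈V
      ; F⊆E    = λ e∈ → contradiction e∈ ∉⊥
      ; isSub  = λ e e∈ → contradiction e∈ ∉⊥
      ; r∈W    = x∈⁅x⁆ r
      ; toRoot = λ u u∈ → subst (Joined G (⁅ r ⁆ ,ᵍ ⊥) u) (x∈⁅y⁆⇒x≡y r u∈) ε
      ; count  = trans (cong suc (∣⊥∣≡0 (size G))) (sym (∣⁅x⁆∣≡1 r))
      }

    addLeaf : (T : RootedSubtree H r) → let open RootedSubtree T in
              ∀ {x y} → Adjacent G H x y → x ∈ W → y ∉ W →
              ∃ λ (T′ : RootedSubtree H r) → ∣ RootedSubtree.W T′ ∣ ≡ suc ∣ W ∣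
    addLeaf T {x} {y} (e , e∈E , ends) x∈W y∉W = record
      { W      = W ∪ ⁅ y ⁆
      ; F      = F ∪ ⁅ e ⁆
      ; W⊆V    = λ z∈ → [ W⊆V , (λ { refl → proj₂ (Adjacent-∈ sub (e , e∈E , ends)) }) ]′ (∈-∪⁅⁆⁻ z∈)
      ; F⊆E    = λ f∈ → [ F⊆E , (λ { refl → e∈E }) ]′ (∈-∪⁅⁆⁻ f∈)
      ; isSub  = isSub′
      ; r∈W    = p⊆p∪q _ r∈W
      ; toRoot = λ u u∈ → [ old u , (λ { refl → yx ◅ old x x∈W }) ]′ (∈-∪⁅⁆⁻ u∈)
      ; count  = trans (cong suc (∣p∪⁅x⁆∣≡1+∣p∣ e∉F)) (trans (cong suc count) (sym (∣p∪⁅x⁆∣≡1+∣p∣ y∉W)))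
      } , ∣p∪⁅x⁆∣≡1+∣p∣ y∉W
      where
      open RootedSubtree T
      W′ = W ∪ ⁅ y ⁆
      -- Edges of the tree have both ends in `W`, but `y` is an end of `e`. So `e` is new, and both
      -- sides of `count` grow by one.
      e∉F : e ∉ F
      e∉F e∈F = y∉W (proj₂ (Adjacent-∈ isSub (e , e∈F , ends)))
      x∈W′ : x ∈ W′
      x∈W′ = p⊆p∪q _ x∈W
      y∈W′ : y ∈ W′
      y∈W′ = q⊆p∪q W _ (x∈⁅x⁆ y)
      isSub′ : IsSubgraph G (W′ ,ᵍ (F ∪ ⁅ e ⁆))
      isSub′ f f∈ with ∈-∪⁅⁆⁻ f∈
      ... | inj₁ f∈F  = let p , q = isSub f f∈F in p⊆p∪q _ p , p⊆p∪q _ q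
      ... | inj₂ refl =
        [ (λ eq → subst (λ p → proj₁ p ∈ W′ × proj₂ p ∈ W′) (sym eq) (x∈W′ , y∈W′))
        , (λ eq → subst (λ p → proj₁ p ∈ W′ × proj₂ p ∈ W′) (sym eq) (y∈W′ , x∈W′)) ]′ ends
      yx : Adjacent G (W′ ,ᵍ (F ∪ ⁅ e ⁆)) y x
      yx = e , q⊆p∪q F _ (x∈⁅x⁆ e) , swap ends
      old : ∀ u → u ∈ W → Joined G (W′ ,ᵍ (F ∪ ⁅ e ⁆)) u r
      old u u∈W = Star.map (λ (f , f∈F , eq) → f , p⊆p∪q _ f∈F , eq) (toRoot u u∈W)

    -- While a vertex of `H` is missing, a walk to it from the root leaves `W` and yields the next
    -- leaf. The fuel `m` drops by one as `∣ W ∣` grows by one, which preserves the bound; at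
    -- `m = 0` the bound contradicts `∣ W ∣ ≤ n`.
    growTree : ∀ m (T : RootedSubtree H r) → n < ∣ RootedSubtree.W T ∣ ℕ.+ m →
               ∃ λ (T′ : RootedSubtree H r) → RootedSubtree.W T′ ≡ V H
    growTree m T n< with any? (λ x → (x ∈? V H) ×-dec ¬? (x ∈? RootedSubtree.W T))
    ... | no none = T , ⊆-antisym (RootedSubtree.W⊆V T) V⊆W
      where
      V⊆W : V H ⊆ RootedSubtree.W T
      V⊆W {x} x∈V with x ∈? RootedSubtree.W T
      ... | yes x∈W = x∈W
      ... | no  x∉W = contradiction (x , x∈V , x∉W) none
    growTree zero T n< | yes _ =
      contradiction (subst (n <_) (ℕ.+-identityʳ _) n<) (ℕ.≤⇒≯ (∣p∣≤n (RootedSubtree.W T)))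
    growTree (suc m) T n< | yes (x , x∈V , x∉W)
      with _ , _ , a , u∈W , v∉W ← crossing (_∈? RootedSubtree.W T) (conn r r∈V x x∈V) (RootedSubtree.r∈W T) x∉W
      with T′ , ∣W′∣ ← addLeaf T a u∈W v∉W =
      growTree m T′ (subst (n <_) (trans (ℕ.+-suc _ m) (cong (ℕ._+ m) (sym ∣W′∣))) n<)

    spanningTree : ∃ λ F → F ⊆ E H × IsSubgraph G (V H ,ᵍ F) × Connected G (V H ,ᵍ F) × suc ∣ F ∣ ≡ ∣ V H ∣
    spanningTree with growTree (suc n) singleton (ℕ.m≤n+m (suc n) _)
    ... | record { F = F ; F⊆E = F⊆E ; isSub = isSub ; toRoot = toRoot ; count = count } , refl =
      F , F⊆E , isSub , hub⇒Connected _ r toRoot , count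

  -- Blocks

  connectedWithoutCutVertex? : Decidable (ConnectedWithoutCutVertex G)
  connectedWithoutCutVertex? X =
    connected? G (induced G X) ×-dec all? λ w → (w ∈? X) →-dec ¬? (isCutVertexOf? G X w)

  -- Replace `X` by a strictly larger connected set without cut vertices as long as one exists; when
  -- the search fails, `X` is a block. The fuel `m` bounds the number of enlargements, each of which
  -- adds at least one vertex.
  ⊆block : ∀ m X → n < ∣ X ∣ ℕ.+ m → ConnectedWithoutCutVertex G X → ∃ λ K → X ⊆ K × IsBlock G K
  ⊆block m X n< cX
    with anySubset? (λ Y → connectedWithoutCutVertex? Y ×-dec (X ⊆? Y) ×-dec any? (λ x → (x ∈? Y) ×-dec ¬? (x ∈? X)))
  ... | no none = X , ⊆-refl , cX , maximal
    where
    maximal : ∀ Y → ConnectedWithoutCutVertex G Y → X ⊆ Y → Y ⊆ X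
    maximal Y cY X⊆Y {x} x∈Y with x ∈? X
    ... | yes x∈X = x∈X
    ... | no  x∉X = ⊥-elim (none (Y , cY , X⊆Y , x , x∈Y , x∉X))
  ⊆block zero X n< cX | yes _ = contradiction (subst (n <_) (ℕ.+-identityʳ _) n<) (ℕ.≤⇒≯ (∣p∣≤n X))
  ⊆block (suc m) X n< cX | yes (Y , cY , X⊆Y , x , x∈Y , x∉X)
    with K , Y⊆K , bK ← ⊆block m Y
           (ℕ.<-≤-trans (subst (n <_) (ℕ.+-suc ∣ X ∣ m) n<)
             (ℕ.+-monoˡ-≤ m (p⊂q⇒∣p∣<∣q∣ (X⊆Y , x , x∈Y , x∉X)))) cY =
    K , ⊆-trans X⊆Y Y⊆K , bK

  -- A simple path from x to b with vertex set X is an element of Path b x X.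
  data Path (b : Fin n) : Fin n → Subset n → Set where
    end  : Path b b ⁅ b ⁆
    step : ∀ {x y X} → x ~ y → x ∉ X → Path b y X → Path b x (X ∪ ⁅ x ⁆)

  start∈ : ∀ {b y X} → Path b y X → y ∈ X
  start∈ {b} end                = x∈⁅x⁆ b
  start∈ {y = y} (step _ _ _)   = q⊆p∪q _ _ (x∈⁅x⁆ y)

  end∈ : ∀ {b y X} → Path b y X → b ∈ X
  end∈ {b} end        = x∈⁅x⁆ b
  end∈ (step _ _ p)   = p⊆p∪q _ (end∈ p)

  suffix : ∀ {b y X x} → Path b y X → x ∈ X → ∃ λ X′ → X′ ⊆ X × Path b x X′
  suffix {b} end x∈ with refl ← x∈⁅y⁆⇒x≡y b x∈ = _ , ⊆-refl , end
  suffix p@(step _ _ p′) x∈ with ∈-∪⁅⁆⁻ x∈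
  ... | inj₂ refl = _ , ⊆-refl , p
  ... | inj₁ x∈X  = let X′ , X′⊆X , q = suffix p′ x∈X in X′ , ⊆-trans X′⊆X (p⊆p∪q _) , q

  -- Loop erasure: if `x` already lies on the path made from the rest of the walk, the suffix from
  -- `x` is taken instead of prepending `x` again.
  walk⇒path : ∀ {Y x b} → b ∈ Y → Joined G (induced G Y) x b → ∃ λ X → X ⊆ Y × Path b x X
  walk⇒path {Y} {b = b} b∈Y ε = _ , (λ z∈ → subst (_∈ Y) (sym (x∈⁅y⁆⇒x≡y b z∈)) b∈Y) , end
  walk⇒path {Y} {x} b∈Y (a ◅ as) with walk⇒path b∈Y as
  ... | X , X⊆Y , p with x ∈? X
  ...   | yes x∈X = let X′ , X′⊆X , q = suffix p x∈X in X′ , ⊆-trans X′⊆X X⊆Y , q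
  ...   | no  x∉X = let x~y , x∈Y , _ = Adjacent-induced⁻ Y a in
    _ , (λ z∈ → [ X⊆Y , (λ { refl → x∈Y }) ]′ (∈-∪⁅⁆⁻ z∈)) , step x~y x∉X p

  path-toEnd : ∀ {b y X} → Path b y X → ∀ {z} → z ∈ X → Joined G (induced G X) z b
  path-toEnd {b} end z∈ with refl ← x∈⁅y⁆⇒x≡y b z∈ = ε
  path-toEnd (step {x} {y} {X} x~y x∉X p) z∈ with ∈-∪⁅⁆⁻ z∈
  ... | inj₁ z∈X  = Joined-induced-mono (p⊆p∪q _) (path-toEnd p z∈X)
  ... | inj₂ refl = Adjacent-induced⁺ _ x~y z∈ (p⊆p∪q _ (start∈ p))
                    ◅ Joined-induced-mono (p⊆p∪q _) (path-toEnd p (start∈ p))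

  -- A vertex w of a path is not on both of the segments joining z ≢ w to the ends.
  path-toSomeEnd : ∀ {b y X} → Path b y X → ∀ {z w} → z ∈ X → z ≢ w →
                   (y ≢ w × Joined G (induced G (X - w)) z y) ⊎
                   (b ≢ w × Joined G (induced G (X - w)) z b)
  path-toSomeEnd {b} end z∈ z≢w with refl ← x∈⁅y⁆⇒x≡y b z∈ = inj₁ (z≢w , ε)
  path-toSomeEnd (step {x} {y} {X} x~y x∉X p) {z} {w} z∈ z≢w with ∈-∪⁅⁆⁻ z∈
  ... | inj₂ refl = inj₁ (z≢w , ε)
  ... | inj₁ z∈X with x ≟ w
  -- Here `w` is the start of the path, so the rest of the path avoids it and leads from `z` to `b`.
  ...   | yes refl = inj₂ ((λ { refl → x∉X (end∈ p) }) ,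
                           Joined-induced-mono
                             (λ u∈X → x∈p∧x≢y⇒x∈p-y (p⊆p∪q _ u∈X) (λ { refl → x∉X u∈X }))
                             (path-toEnd p z∈X))
  ...   | no x≢w with path-toSomeEnd p z∈X z≢w
  -- A segment that reaches the second vertex `y` is prolonged to the start by the edge between `y`
  -- and `x`.
  ...     | inj₁ (y≢w , zy) = inj₁ (x≢w , Joined-induced-mono (-⊆- (p⊆p∪q _)) zy ◅◅
              (Adjacent-induced⁺ _ (~-sym x~y) (x∈p∧x≢y⇒x∈p-y (p⊆p∪q _ (start∈ p)) y≢w)
                (x∈p∧x≢y⇒x∈p-y (q⊆p∪q _ _ (x∈⁅x⁆ x)) x≢w) ◅ ε))
  ...     | inj₂ (b≢w , zb) = inj₂ (b≢w , Joined-induced-mono (-⊆- (p⊆p∪q _)) zb)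

  -- The path closes through `v` to a cycle (a single edge if `a = b`), which stays connected when
  -- any `w` is deleted. If `w` is `v`, the path remains; otherwise each vertex reaches an end of
  -- the path along a segment that avoids `w`, and from there `v`.
  cycle-withoutCutVertex : ∀ {a b v X} → Path b a X → v ∉ X → v ~ a → v ~ b →
                           ConnectedWithoutCutVertex G (X ∪ ⁅ v ⁆)
  cycle-withoutCutVertex {a} {b} {v} {X} p v∉X v~a v~b =
    hub⇒Connected _ v toHub , λ w _ (_ , u , t , u∈ , t∈ , _ , ¬ut) → ¬ut (avoid w u u∈ t t∈)
    where
    Y = X ∪ ⁅ v ⁆
    v∈Y : v ∈ Y
    v∈Y = q⊆p∪q X _ (x∈⁅x⁆ v)
    toHub : ∀ u → u ∈ Y → Joined G (induced G Y) u v
    toHub u u∈ with ∈-∪⁅⁆⁻ u∈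
    ... | inj₂ refl = ε
    ... | inj₁ u∈X  = Joined-induced-mono (p⊆p∪q _) (path-toEnd p u∈X) ◅◅
                      (Adjacent-induced⁺ Y (~-sym v~b) (p⊆p∪q _ (end∈ p)) v∈Y ◅ ε)
    Y-v⊆X : ∀ {u} → u ∈ Y - v → u ∈ X
    Y-v⊆X u∈ with ∈-∪⁅⁆⁻ (p-x⊆p u∈)
    ... | inj₁ u∈X = u∈X
    ... | inj₂ u≡v = contradiction u≡v (x∈p-y⇒x≢y u∈)
    avoid : ∀ w → Connected G (induced G (Y - w))
    avoid w with w ≟ v
    ... | yes refl = hub⇒Connected _ b λ u u∈ → Joined-induced-mono
            (λ z∈X → x∈p∧x≢y⇒x∈p-y (p⊆p∪q _ z∈X) (λ { refl → v∉X z∈X })) (path-toEnd p (Y-v⊆X u∈))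
    ... | no w≢v = hub⇒Connected _ v around
      where
      v∈Y-w : v ∈ Y - w
      v∈Y-w = x∈p∧x≢y⇒x∈p-y v∈Y (w≢v ∘ sym)
      around : ∀ u → u ∈ Y - w → Joined G (induced G (Y - w)) u v
      around u u∈ with ∈-∪⁅⁆⁻ (p-x⊆p u∈)
      ... | inj₂ refl = ε
      ... | inj₁ u∈X with path-toSomeEnd p u∈X (x∈p-y⇒x≢y u∈)
      ...   | inj₁ (a≢w , ua) = Joined-induced-mono (-⊆- (p⊆p∪q _)) ua ◅◅
                (Adjacent-induced⁺ _ (~-sym v~a) (x∈p∧x≢y⇒x∈p-y (p⊆p∪q _ (start∈ p)) a≢w) v∈Y-w ◅ ε)
      ...   | inj₂ (b≢w , ub) = Joined-induced-mono (-⊆- (p⊆p∪q _)) ub ◅◅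
                (Adjacent-induced⁺ _ (~-sym v~b) (x∈p∧x≢y⇒x∈p-y (p⊆p∪q _ (end∈ p)) b≢w) v∈Y-w ◅ ε)

  -- If `a` and `b` were not joined in `G - v`, they would witness that `v` is a cut vertex. A walk
  -- between them gives a cycle through `v`, and a block around this cycle is a clique that contains
  -- both.
  nonCutVertex-simplicial : IsConnected G → IsBlockGraph G → ∀ {v} → ¬ IsCutVertexOf G ⊤ v →
                            ∀ {a b} → v ~ a → v ~ b → a ≢ b → a ~ b
  nonCutVertex-simplicial conn block {v} ¬cut {a} {b} v~a v~b a≢b with joined? G (induced G (⊤ - v)) a b
  ... | no ¬ab = contradiction (∈⊤ , a , b , ≢v v~a , ≢v v~b , conn a ∈⊤ b ∈⊤ , ¬ab) ¬cut
    where
    ≢v : ∀ {u} → v ~ u → u ∈ ⊤ - v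
    ≢v v~u = x∈p∧x≢y⇒x∈p-y ∈⊤ λ { refl → ~-irrefl refl v~u }
  ... | yes ab =
    let b∈ = x∈p∧x≢y⇒x∈p-y ∈⊤ λ { refl → ~-irrefl refl v~b }
        X , X⊆ , p = walk⇒path b∈ ab
        v∉X = λ v∈X → x∈p-y⇒x≢y (X⊆ v∈X) refl
        K , Y⊆K , bK = ⊆block (suc n) (X ∪ ⁅ v ⁆) (ℕ.m≤n+m (suc n) _) (cycle-withoutCutVertex p v∉X v~a v~b)
    in block K bK a b (Y⊆K (p⊆p∪q _ (start∈ p))) (Y⊆K (p⊆p∪q _ (end∈ p))) a≢b

  -- Each passage of a walk from `y` through `v` to `z` is cut short by the edge between `y` and
  -- `z`, or dropped if `y = z`. The new edge may be missing from `H`, hence the induced subgraph in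
  -- the conclusion.
  bypass : ∀ {v} → (∀ {a b} → v ~ a → v ~ b → a ≢ b → a ~ b) →
           ∀ {H} → IsSubgraph G H → Connected G H → Connected G (induced G (V H - v))
  bypass {v} simplicial {H} sub conn u u∈ w w∈ =
    direct (x∈p-y⇒x≢y u∈) (conn u (p-x⊆p u∈) w (p-x⊆p w∈))
    where
    w≢v = x∈p-y⇒x≢y w∈
    Xv = V H - v
    -- `direct` follows the walk while it is off `v`; `around` takes over when it stands at `v`, and
    -- keeps the vertex `y` from which `v` was entered.
    direct : ∀ {x} → x ≢ v → Joined G H x w → Joined G (induced G Xv) x w
    around : ∀ {y} → y ∈ Xv → v ~ y → Joined G H v w → Joined G (induced G Xv) y w
    direct x≢v ε = ε
    direct {x} x≢v (_◅_ {j = z} a as) with z ≟ v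
    ... | yes refl = around (x∈p∧x≢y⇒x∈p-y (proj₁ (Adjacent-∈ sub a)) x≢v) (~-sym (Adjacent⇒~ H a)) as
    ... | no z≢v = let x∈ , z∈ = Adjacent-∈ sub a in
      Adjacent-induced⁺ Xv (Adjacent⇒~ H a) (x∈p∧x≢y⇒x∈p-y x∈ x≢v) (x∈p∧x≢y⇒x∈p-y z∈ z≢v)
      ◅ direct z≢v as
    around y∈ v~y ε = contradiction refl w≢v
    around {y} y∈ v~y (_◅_ {j = z} a as) with y ≟ z
    ... | yes refl = direct (x∈p-y⇒x≢y y∈) as
    ... | no y≢z =
      let v~z = Adjacent⇒~ H a
          z≢v = λ z≡v → ~-irrefl (sym z≡v) v~z
      in Adjacent-induced⁺ Xv (simplicial v~y v~z y≢z) y∈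
           (x∈p∧x≢y⇒x∈p-y (proj₂ (Adjacent-∈ sub a)) z≢v)
         ◅ direct z≢v as

  -- Steiner trees

  vertexEdgeSets-complete : ∀ H → H ∈ˡ vertexEdgeSets G
  vertexEdgeSets-complete (W ,ᵍ F) =
    ∈-map⁺ (λ (W , F) → W ,ᵍ F) (∈-cartesianProduct⁺ (subsets-complete W) (subsets-complete F))

  steinerDistance-≤ : ∀ {S} H → Connects G S H → steinerDistance G S ≤ ∣ E H ∣
  steinerDistance-≤ {S} H c = All.lookup (min≤xs (size G) (map (λ H → ∣ E H ∣) (filter (connects? G S) (vertexEdgeSets G))))
    (∈-map⁺ (λ H → ∣ E H ∣) (∈-filter⁺ (connects? G S) (vertexEdgeSets-complete H) c))

  steinerTree-exists : IsConnected G → ∀ S → ∃ λ H → H ∈ˡ steinerTrees G S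
  steinerTree-exists conn S =
    [ whole , attained ]′ (argmin-sel id (size G) (map (λ H → ∣ E H ∣) (filter (connects? G S) (vertexEdgeSets G))))
    where
    G⊤ = induced G ⊤
    c : Connects G S G⊤
    c = induced-isSubgraph ⊤ , conn , λ _ → ∈⊤
    -- If the minimum is the default value, `G` itself attains it: it has at most `size G` edges
    -- and, by minimality, no fewer.
    whole : steinerDistance G S ≡ size G → ∃ λ H → H ∈ˡ steinerTrees G S
    whole d≡size = G⊤ , ∈-filter⁺ (isSteinerTree? G S) (vertexEdgeSets-complete G⊤)
      (c , ℕ.≤-antisym (subst (∣ E G⊤ ∣ ≤_) (sym d≡size) (∣p∣≤n (E G⊤))) (steinerDistance-≤ G⊤ c))
    attained : steinerDistance G S ∈ˡ map (λ H → ∣ E H ∣) (filter (connects? G S) (vertexEdgeSets G)) →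
               ∃ λ H → H ∈ˡ steinerTrees G S
    attained d∈ =
      let H , H∈ , d≡ = ∈-map⁻ (λ H → ∣ E H ∣) d∈
          m , c = ∈-filter⁻ (connects? G S) {xs = vertexEdgeSets G} H∈
      in H , ∈-filter⁺ (isSteinerTree? G S) m (c , sym d≡)

  ∈-steinerTrees⁻ : ∀ {S H} → H ∈ˡ steinerTrees G S → IsSteinerTree G S H
  ∈-steinerTrees⁻ {S} H∈ = proj₂ (∈-filter⁻ (isSteinerTree? G S) {xs = vertexEdgeSets G} H∈)

  -- A spanning tree of `H` still connects `S`, so it has at least `d(S)` edges; its edges are among
  -- the `d(S)` edges of `H`. Hence it has exactly `d(S)` edges and `d(S) + 1` vertices, which are
  -- those of `H`.
  steinerTree-∣V∣ : ∀ {S r H} → r ∈ S → IsSteinerTree G S H → suc (steinerDistance G S) ≡ ∣ V H ∣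
  steinerTree-∣V∣ {S} {r} {H} r∈S ((sub , conn , S⊆V) , ∣E∣≡d) =
    let F , F⊆E , sub′ , conn′ , ∣F∣ = spanningTree sub conn (S⊆V r∈S)
    in trans (cong suc (ℕ.≤-antisym (steinerDistance-≤ (V H ,ᵍ F) (sub′ , conn′ , S⊆V))
                                 (subst (∣ F ∣ ≤_) ∣E∣≡d (p⊆q⇒∣p∣≤∣q∣ F⊆E)))) ∣F∣

  -- If `v` were inner, a spanning tree of the subgraph induced on `V H - v` would connect `S` with
  -- `∣ V H ∣ - 2 = d(S) - 1` edges.
  nonCutVertex-notInner : IsConnected G → IsBlockGraph G → ∀ {v} → ¬ IsCutVertexOf G ⊤ v →
                          ∀ {S r H} → r ∈ S → IsSteinerTree G S H → ¬ IsInnerVertex G S H v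
  nonCutVertex-notInner connG block {v} ¬cut {S} {r} {H} r∈S T@((sub , conn , S⊆V) , _) (v∈V , v∉S)
    with F , _ , sub′ , conn′ , ∣F∣ ←
      spanningTree (induced-isSubgraph (V H - v))
                   (bypass (nonCutVertex-simplicial connG block ¬cut) sub conn)
                   (x∈p∧x≢y⇒x∈p-y (S⊆V r∈S) λ { refl → v∉S r∈S }) =
    ℕ.<⇒≱ (x∈p⇒∣p-x∣<∣p∣ v∈V) (begin
      ∣ V H ∣                   ≡⟨ steinerTree-∣V∣ r∈S T ⟨
      suc (steinerDistance G S) ≤⟨ ℕ.s≤s (steinerDistance-≤ ((V H - v) ,ᵍ F) (sub′ , conn′ , S⊆)) ⟩
      suc ∣ F ∣                 ≡⟨ ∣F∣ ⟩
      ∣ V H - v ∣               ∎)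
    where
    open ℕ.≤-Reasoning
    S⊆ : S ⊆ V H - v
    S⊆ x∈S = x∈p∧x≢y⇒x∈p-y (S⊆V x∈S) λ { refl → v∉S x∈S }

  -- Double counting

  innerVertices-count : ∀ {S r H} → r ∈ S → IsSteinerTree G S H →
                        length (filter (isInnerVertex? G S H) (allFin n)) ≡ steinerDistance G S ∸ (∣ S ∣ ∸ 1)
  innerVertices-count {S} {r} {H} r∈S T@((_ , _ , S⊆V) , _) = begin
    length (filter (isInnerVertex? G S H) (allFin n)) ≡⟨ length-filter-tabulate (isInnerVertex? G S H) id (V H ─ S)
                                                          (λ (v∈V , v∉S) → x∈p∧x∉q⇒x∈p─q v∈V v∉S)
                                                          (λ v∈ → p─q⊆p (V H) S v∈ , x∈p─q⇒x∉q v∈) ⟩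
    ∣ V H ─ S ∣                                       ≡⟨ ℕ.m+n∸n≡m _ ∣ S ∣ ⟨
    ∣ V H ─ S ∣ ℕ.+ ∣ S ∣ ∸ ∣ S ∣                      ≡⟨ cong (_∸ ∣ S ∣) (∣q─p∣+∣p∣≡∣q∣ S⊆V) ⟩
    ∣ V H ∣ ∸ ∣ S ∣                                    ≡⟨ cong (_∸ ∣ S ∣) (steinerTree-∣V∣ r∈S T) ⟨
    -- As `S` is nonempty, `∣ S ∣` is a successor, and the two successors cancel by computation.
    suc (steinerDistance G S) ∸ ∣ S ∣                  ≡⟨ cong (suc (steinerDistance G S) ∸_) 1+∣S∣∸1 ⟨
    steinerDistance G S ∸ (∣ S ∣ ∸ 1)                  ∎
    where
    open ≡-Reasoning
    1+∣S∣∸1 : suc (∣ S ∣ ∸ 1) ≡ ∣ S ∣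
    1+∣S∣∸1 = ℕ.m+[n∸m]≡n (ℕ.≤-trans (ℕ.s≤s ℕ.z≤n) (x∈p⇒∣p-x∣<∣p∣ r∈S))

  -- A Steiner tree has `d(S) + 1` vertices, all terminals among them. This makes the truncated
  -- difference in `innerVertices-count` a genuine one.
  ∣S∣∸1≤steinerDistance : IsConnected G → ∀ {S r} → r ∈ S → ∣ S ∣ ∸ 1 ≤ steinerDistance G S
  ∣S∣∸1≤steinerDistance conn {S} r∈S =
    let H , H∈ = steinerTree-exists conn S
        T@((_ , _ , S⊆V) , _) = ∈-steinerTrees⁻ {S} {H} H∈
    in ℕ.∸-monoˡ-≤ 1 (ℕ.≤-trans (p⊆q⇒∣p∣≤∣q∣ S⊆V) (ℕ.≤-reflexive (sym (steinerTree-∣V∣ r∈S T))))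

  σ≢0 : IsConnected G → ∀ S → σ G S ≢ 0
  σ≢0 conn S = ∈⇒length≢0 (proj₂ (steinerTree-exists conn S))

  -- Both sides count the pairs of a Steiner tree for `S` and an inner vertex of it: by vertices on
  -- the left, by trees on the right.
  Σσ-inner : ∀ {S r} → r ∈ S →
             sum (map (σ-inner G S) (allFin n)) ≡ σ G S * (steinerDistance G S ∸ (∣ S ∣ ∸ 1))
  Σσ-inner {S} r∈S = trans
    (sum-length-filter-swap {R = λ v H → IsInnerVertex G S H v}
      (λ v H → isInnerVertex? G S H v) (allFin n) (steinerTrees G S))
    (sum-map-constant (λ H → length (filter (isInnerVertex? G S H) (allFin n))) (steinerTrees G S)
      λ {H} H∈ → innerVertices-count {H = H} r∈S (∈-steinerTrees⁻ {S} {H} H∈))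

  -- The contribution of a single set `S` to the formula, stated additively to avoid subtraction.
  Σratio : IsConnected G → ∀ {S r} → r ∈ S →
           sumℚ (map (λ v → ratio (σ-inner G S v) (σ G S)) (allFin n)) + ratio (∣ S ∣ ∸ 1) 1 ≡
           ratio (steinerDistance G S) 1
  Σratio conn {S} r∈S = begin
    sumℚ (map (λ v → ratio (σ-inner G S v) (σ G S)) (allFin n)) + ratio m 1
      ≡⟨ cong (_+ ratio m 1) (sum-ratio (σ G S) (σ-inner G S) (allFin n)) ⟩
    ratio (sum (map (σ-inner G S) (allFin n))) (σ G S) + ratio m 1
      ≡⟨ cong (λ a → ratio a (σ G S) + ratio m 1) (Σσ-inner r∈S) ⟩
    ratio (σ G S * (d ∸ m)) (σ G S) + ratio m 1
      ≡⟨ cong (_+ ratio m 1) (ratio-cancel (σ G S) (d ∸ m) (σ≢0 conn S)) ⟩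
    ratio (d ∸ m) 1 + ratio m 1
      ≡⟨ ratio-+ (d ∸ m) m 1 ⟩
    ratio (d ∸ m ℕ.+ m) 1
      ≡⟨ cong (λ a → ratio a 1) (ℕ.m∸n+n≡m (∣S∣∸1≤steinerDistance conn r∈S)) ⟩
    ratio d 1 ∎
    where
    open ≡-Reasoning
    m = ∣ S ∣ ∸ 1
    d = steinerDistance G S

  σ-inner≡0 : ∀ S v → (∀ H → IsSteinerTree G S H → ¬ IsInnerVertex G S H v) → σ-inner G S v ≡ 0
  σ-inner≡0 S v none = length-filter-none (λ H → isInnerVertex? G S H v) (steinerTrees G S)
    λ H H∈ → none H (∈-steinerTrees⁻ {S} {H} H∈)

-- Summation over the sets of size `k`

∈-subsetsOfSize⁻ : ∀ {n k S} → S ∈ˡ subsetsOfSize n k → ∣ S ∣ ≡ k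
∈-subsetsOfSize⁻ {n} {k} S∈ = proj₂ (∈-filter⁻ (λ S → ∣ S ∣ ℕ.≟ k) {xs = subsets n} S∈)

mainTheorem5 : ∀ (n : ℕ) (G : Graph n) → IsConnected G → IsBlockGraph G →
    ∀ (k : ℕ) → 2 ≤ k → k ≤ n →
    + SW G k / 1 ≡ sumℚ (map (B G k) (cutVertices G)) + + ((k ∸ 1) * (n C k)) / 1
mainTheorem5 n G conn block k 2≤k _ = begin
  -- `ratio a 1` unfolds to `+ a / 1`, so the chain starts and ends with the two sides of the
  -- theorem.
  ratio (SW G k) 1                                     ≡⟨ sum-ratio 1 (steinerDistance G) subs ⟨
  sumℚ (map (λ S → ratio (steinerDistance G S) 1) subs) ≡⟨ sumℚ-cong _ _ subs perSubset ⟨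
  sumℚ (map (λ S → R S + c) subs)                      ≡⟨ sumℚ-map-+ R (λ _ → c) subs ⟩
  sumℚ (map R subs) + sumℚ (map (λ _ → c) subs)        ≡⟨ cong₂ _+_ (sumℚ-swap r subs (allFin n)) constant ⟩
  sumℚ (map B′ (allFin n)) + t                         ≡⟨ cong (_+ t) (sumℚ-cong B′ (B G k) (allFin n) λ {v} _ → avoiding v) ⟩
  sumℚ (map (B G k) (allFin n)) + t                    ≡⟨ cong (_+ t) nonCut ⟩
  sumℚ (map (B G k) (cutVertices G)) + t               ∎
  where
  open ≡-Reasoning
  subs = subsetsOfSize n k

  r : Subset n → Fin n → ℚ
  r S v = ratio (σ-inner G S v) (σ G S)

  R : Subset n → ℚ
  R S = sumℚ (map (r S) (allFin n))

  B′ : Fin n → ℚ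
  B′ v = sumℚ (map (λ S → r S v) subs)

  c t : ℚ
  c = ratio (k ∸ 1) 1
  t = ratio ((k ∸ 1) * (n C k)) 1

  -- The lower bound on `k` supplies a terminal, from which the spanning trees are grown.
  terminal : ∀ {S} → S ∈ˡ subs → ∃ λ x → x ∈ S
  terminal {S} S∈ = 1≤∣p∣⇒nonempty (ℕ.≤-trans (ℕ.≤-trans (ℕ.n≤1+n 1) 2≤k) (ℕ.≤-reflexive (sym (∈-subsetsOfSize⁻ S∈))))

  perSubset : ∀ {S} → S ∈ˡ subs → sumℚ (map (r S) (allFin n)) + ratio (k ∸ 1) 1 ≡ ratio (steinerDistance G S) 1
  perSubset {S} S∈ = subst (λ j → sumℚ (map (r S) (allFin n)) + ratio (j ∸ 1) 1 ≡ ratio (steinerDistance G S) 1)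
    (∈-subsetsOfSize⁻ S∈) (Σratio G conn (proj₂ (terminal S∈)))

  constant : sumℚ (map (λ _ → ratio (k ∸ 1) 1) subs) ≡ ratio ((k ∸ 1) * (n C k)) 1
  constant = trans (sum-ratio 1 (λ _ → k ∸ 1) subs) (cong (λ a → ratio a 1)
    (trans (sum-map-constant (λ _ → k ∸ 1) subs λ _ → refl)
      (trans (cong (_* (k ∸ 1)) (length-subsetsOfSize n k)) (ℕ.*-comm (n C k) (k ∸ 1)))))

  r≡0 : ∀ S v → (∀ H → IsSteinerTree G S H → ¬ IsInnerVertex G S H v) → r S v ≡ 0ℚ
  r≡0 S v none = trans (cong (λ a → ratio a (σ G S)) (σ-inner≡0 G S v none)) (ratio-zero (σ G S))

  -- `B′` sums over all sets of size `k`, `B` only over those without `v`. The extra terms vanish,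
  -- because a terminal is never an inner vertex.
  avoiding : ∀ v → sumℚ (map (λ S → r S v) subs) ≡ B G k v
  avoiding v = sumℚ-filter (λ S → ¬? (v ∈? S)) (λ S → r S v) subs
    λ {S} _ ¬v∉S → r≡0 S v λ _ _ (_ , v∉S) → ¬v∉S v∉S

  B≡0 : ∀ {v} → ¬ IsCutVertexOf G ⊤ v → B G k v ≡ 0ℚ
  B≡0 {v} ¬cut = sumℚ-zero _ _ λ {S} S∈ →
    let S∈subs = proj₁ (∈-filter⁻ (λ S → ¬? (v ∈? S)) {xs = subs} S∈)
    in r≡0 S v λ H → nonCutVertex-notInner G conn block ¬cut {S} {H = H} (proj₂ (terminal S∈subs))

  nonCut : sumℚ (map (B G k) (allFin n)) ≡ sumℚ (map (B G k) (cutVertices G))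
  nonCut = sumℚ-filter (isCutVertexOf? G ⊤) (B G k) (allFin n) λ _ → B≡0
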